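{- For every $\varepsilon>0$ there exists $n_0\in\mathbb{N}$ such that for every integer $n\geq n_0$, every equi-$n$ square has a transversal of size at least $(3/4-\varepsilon)n$.
   Context: An equi-$n$ square is an $n\times n$ array filled with $n$ symbols, each symbol appearing exactly $n$ times. A transversal in an array filled with symbols is a collection of entries of the array no two of which share a row, a column, or a symbol; its size is the number of entries. -}

module Defs where

open import Data.Nat using (ℕ)
open import Data.Fin using (Fin)
open import Data.Fin.Properties using (_≟_)
open import Data.Product using (_×_; _,_; proj₁; proj₂)
open import Data.List using (List; length; map; filter; allFin; cartesianProduct)
open import Data.List.Relation.Unary.Unique.Propositional using (Unique)
open import Relation.Binary.PropositionalEquality using (_≡_)

Array : ℕ → Set
Array n = Fin n → Fin n → Fin n

cells : (n : ℕ) → List (Fin n × Fin n)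
cells n = cartesianProduct (allFin n) (allFin n)

occurrences : {n : ℕ} → Array n → Fin n → ℕ
occurrences {n} L s = length (filter (λ c → L (proj₁ c) (proj₂ c) ≟ s) (cells n))

IsEquiSquare : {n : ℕ} → Array n → Set
IsEquiSquare {n} L = (s : Fin n) → occurrences L s ≡ n

-- A transversal: a list of distinct entries (cells), no two sharing a row,
-- a column or a symbol. Its size is the length of the list.
record IsTransversal {n : ℕ} (L : Array n) (T : List (Fin n × Fin n)) : Set where
  field
    rowsDistinct    : Unique (map proj₁ T)
    colsDistinct    : Unique (map proj₂ T)
    symbolsDistinct : Unique (map (λ c → L (proj₁ c) (proj₂ c)) T)

{-# OPTIONS --safe #-}
module Submission where

-- Let T be a transversal of size t, and let R₀, C₀ be the rows and columns it
-- misses.  Starting from X₀ = ∅, let Rᵢ, Cᵢ be R₀, C₀ together with the rows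
-- and columns of the entries in Xᵢ ⊆ T, and let Xᵢ₊₁ ⊇ Xᵢ collect the entries
-- of T whose symbol occurs at least g times in Rᵢ × Cᵢ.  Such an entry can be
-- moved to another copy of its symbol inside Rᵢ × Cᵢ, after recursively freeing
-- the row and the column of that copy.
--
-- A symbol may have all its copies in a single row, so these moves can conflict.
-- But for any bounded set of lines that must not be disturbed, only boundedly
-- many entries of Xᵢ cannot be freed: an exceptional entry uses up g of the O(n)
-- cells whose row and column cannot be freed together, and n/g is bounded.
--
-- Hence, if T cannot be enlarged, all but O(n) cells of Rᵢ × Cᵢ carry symbols
-- of T, which gives (n - t + |Xᵢ|)² ≤ n |Xᵢ₊₁| + g n + O(n).  If n - t ≥ n/4 + 6g,
-- AM-GM makes the left-hand side at least n |Xᵢ| + 3 g n, so |Xᵢ| grows by g at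
-- every step, which is impossible after n/g + 1 steps.

open import Defs
open import Data.Nat using (ℕ; suc; _≥_)
import Data.Nat as ℕ
import Data.Nat.DivMod as ℕ
import Data.Nat.Properties as ℕ
import Data.Nat.Tactic.RingSolver as ℕ-Ring
open import Data.Nat.Coprimality using (Coprime)
open import Data.Fin using (Fin)
open import Data.Product using (Σ; _×_; _,_; proj₁; proj₂)
open import Data.List using (List; length; upTo)
open import Data.List.Membership.Propositional.Properties using (∈-upTo⁺)
open import Relation.Binary.PropositionalEquality using (_≡_; _≢_; refl; sym; trans; cong; cong₂; subst; module ≡-Reasoning)

module EquiSquare where

  open import Data.Nat using (zero; _+_; _*_; _≤_; z≤n; s≤s; NonZero; >-nonZero; >-nonZero⁻¹; _≤?_)
  open import Data.Nat.DivMod using (_/_; _%_; m≡m%n+[m/n]*n; m%n≤n; m*n/n≡m; /-monoˡ-≤)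
  open import Data.Nat.Properties hiding (_≟_)
  open import Data.Nat.Tactic.RingSolver using (solve-∀)
  open import Data.Bool using (Bool; true; false; if_then_else_)
  import Data.Bool.Properties as Bool
  open import Data.Fin using (zero; suc)
  open import Data.Fin.Properties using (_≟_; all?; any?)
  open import Data.Product using (∃)
  open import Data.Product.Properties using (≡-dec; ,-injective)
  open import Data.Sum using (_⊎_; inj₁; inj₂; [_,_]′)
  open import Data.List using ([]; _∷_; _++_; map; filter; cartesianProduct; allFin; concatMap)
  open import Data.List.Properties using (map-∘; length-map; length-++; length-tabulate)
  open import Data.List.Relation.Unary.Any as Any using (here; there)
  open import Data.List.Relation.Unary.All using (All; []; _∷_)
  open import Data.List.Relation.Unary.AllPairs using ([]; _∷_)
  open import Data.List.Relation.Unary.Unique.Propositional using (Unique)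
  import Data.List.Relation.Unary.Unique.Propositional.Properties as Unique
  open import Data.List.Membership.Propositional using (_∈_; _∉_; lose)
  open import Data.List.Membership.Propositional.Properties using (∈-map⁺; ∈-++⁺ˡ; ∈-++⁺ʳ; ∈-concatMap⁺; ∈-cartesianProduct⁺; ∈-allFin; ∈-filter⁺; ∈-filter⁻)
  import Data.List.Membership.DecPropositional as DecMembership
  open import Data.Vec.Functional using (updateAt)
  open import Data.Vec.Functional.Properties using (updateAt-updates; updateAt-minimal)
  open import Function using (_∘_; const)
  open import Relation.Nullary using (Dec; yes; no; does; ¬_; contradiction)
  open import Relation.Nullary.Decidable using (_×-dec_; _⊎-dec_; ¬?)
  open import Relation.Unary using (Decidable)
  open import Relation.Binary.Definitions using (DecidableEquality)

  -- Indicators and sums over lists.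

  private variable
    A B P Q R : Set

  ∑ : List A → (A → ℕ) → ℕ
  ∑ []       f = 0
  ∑ (x ∷ xs) f = f x + ∑ xs f

  𝟙 : Dec P → ℕ
  𝟙 d = if does d then 1 else 0

  𝟙≤ : (d : Dec P) {m : ℕ} → (P → 1 ≤ m) → 𝟙 d ≤ m
  𝟙≤ (yes p) 1≤m = 1≤m p
  𝟙≤ (no _)  1≤m = z≤n

  *𝟙≤ : {m v : ℕ} (d : Dec P) → (P → m ≤ v) → m * 𝟙 d ≤ v
  *𝟙≤ {m = m} (yes p) m≤v = ≤-trans (≤-reflexive (*-identityʳ m)) (m≤v p)
  *𝟙≤ {m = m} (no _)  m≤v = ≤-trans (≤-reflexive (*-zeroʳ m)) z≤n

  𝟙*𝟙≤𝟙*𝟙 : (d : Dec P) (e : Dec Q) (f : Dec R) → (P → R → Q) → 𝟙 d * 𝟙 f ≤ 𝟙 e * 𝟙 f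
  𝟙*𝟙≤𝟙*𝟙 (no _)  e       f       h = z≤n
  𝟙*𝟙≤𝟙*𝟙 (yes _) (yes _) f       h = ≤-refl
  𝟙*𝟙≤𝟙*𝟙 (yes p) (no ¬q) (yes r) h = contradiction (h p r) ¬q
  𝟙*𝟙≤𝟙*𝟙 (yes _) (no _)  (no _)  h = z≤n

  1≤𝟙 : (d : Dec P) → P → 1 ≤ 𝟙 d
  1≤𝟙 (yes _) _ = ≤-refl
  1≤𝟙 (no ¬p) p = contradiction p ¬p

  𝟙-× : (d : Dec P) (e : Dec Q) → 𝟙 (d ×-dec e) ≡ 𝟙 d * 𝟙 e
  𝟙-× (yes _) (yes _) = refl
  𝟙-× (yes _) (no _)  = refl
  𝟙-× (no _)  (yes _) = refl
  𝟙-× (no _)  (no _)  = refl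

  ∑-mono : {f g : A → ℕ} (xs : List A) → (∀ x → f x ≤ g x) → ∑ xs f ≤ ∑ xs g
  ∑-mono []       f≤g = z≤n
  ∑-mono (x ∷ xs) f≤g = +-mono-≤ (f≤g x) (∑-mono xs f≤g)

  ∑-cong : {f g : A → ℕ} (xs : List A) → (∀ x → f x ≡ g x) → ∑ xs f ≡ ∑ xs g
  ∑-cong []       f≡g = refl
  ∑-cong (x ∷ xs) f≡g = cong₂ _+_ (f≡g x) (∑-cong xs f≡g)

  ∑-const : (xs : List A) (c : ℕ) → ∑ xs (λ _ → c) ≡ length xs * c
  ∑-const []       c = refl
  ∑-const (x ∷ xs) c = cong (c +_) (∑-const xs c)

  ∑-+ : (xs : List A) (f g : A → ℕ) → ∑ xs (λ x → f x + g x) ≡ ∑ xs f + ∑ xs g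
  ∑-+ []       f g = refl
  ∑-+ (x ∷ xs) f g rewrite ∑-+ xs f g = lemma (f x) (g x) (∑ xs f) (∑ xs g)
    where
    lemma : ∀ a b c d → a + b + (c + d) ≡ a + c + (b + d)
    lemma = solve-∀

  ∑-*ˡ : (xs : List A) (c : ℕ) (f : A → ℕ) → ∑ xs (λ x → c * f x) ≡ c * ∑ xs f
  ∑-*ˡ []       c f = sym (*-zeroʳ c)
  ∑-*ˡ (x ∷ xs) c f rewrite ∑-*ˡ xs c f = sym (*-distribˡ-+ c (f x) (∑ xs f))

  ∑-swap : (xs : List A) (ys : List B) (f : A → B → ℕ) →
           ∑ xs (λ x → ∑ ys (f x)) ≡ ∑ ys (λ y → ∑ xs (λ x → f x y))
  ∑-swap []       ys f = sym (trans (∑-const ys 0) (*-zeroʳ (length ys)))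
  ∑-swap (x ∷ xs) ys f rewrite ∑-swap xs ys f = sym (∑-+ ys (f x) _)

  ∑-++ : (xs ys : List A) (f : A → ℕ) → ∑ (xs ++ ys) f ≡ ∑ xs f + ∑ ys f
  ∑-++ []       ys f = refl
  ∑-++ (x ∷ xs) ys f rewrite ∑-++ xs ys f = sym (+-assoc (f x) _ _)

  ∑-map : (h : A → B) (xs : List A) (f : B → ℕ) → ∑ (map h xs) f ≡ ∑ xs (λ x → f (h x))
  ∑-map h []       f = refl
  ∑-map h (x ∷ xs) f = cong (f (h x) +_) (∑-map h xs f)

  ∑-cartesianProduct : (xs : List A) (ys : List B) (f : A → ℕ) (g : B → ℕ) →
    ∑ (cartesianProduct xs ys) (λ p → f (proj₁ p) * g (proj₂ p)) ≡ ∑ xs f * ∑ ys g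
  ∑-cartesianProduct []       ys f g = refl
  ∑-cartesianProduct (x ∷ xs) ys f g = begin
    ∑ (map (x ,_) ys ++ cartesianProduct xs ys) fg      ≡⟨ ∑-++ (map (x ,_) ys) _ fg ⟩
    ∑ (map (x ,_) ys) fg + ∑ (cartesianProduct xs ys) fg
      ≡⟨ cong₂ _+_ (trans (∑-map (x ,_) ys fg) (∑-*ˡ ys (f x) g)) (∑-cartesianProduct xs ys f g) ⟩
    f x * ∑ ys g + ∑ xs f * ∑ ys g                      ≡⟨ *-distribʳ-+ (∑ ys g) (f x) (∑ xs f) ⟨
    (f x + ∑ xs f) * ∑ ys g                             ∎
    where
    open ≡-Reasoning
    fg = λ p → f (proj₁ p) * g (proj₂ p)

  length-cartesianProduct : (xs : List A) (ys : List B) →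
    length (cartesianProduct xs ys) ≡ length xs * length ys
  length-cartesianProduct []       ys = refl
  length-cartesianProduct (x ∷ xs) ys =
    trans (length-++ (map (x ,_) ys))
          (cong₂ _+_ (length-map (x ,_) ys) (length-cartesianProduct xs ys))

  length-concatMap≤ : ∀ (f : A → List B) c xs → (∀ x → length (f x) ≤ c) →
                      length (concatMap f xs) ≤ length xs * c
  length-concatMap≤ f c []       f≤ = z≤n
  length-concatMap≤ f c (x ∷ xs) f≤ = ≤-trans (≤-reflexive (length-++ (f x)))
    (+-mono-≤ (f≤ x) (length-concatMap≤ f c xs f≤))

  length-allFin : ∀ m → length (allFin m) ≡ m
  length-allFin m = length-tabulate {n = m} (λ i → i)

  term≤∑ : {x : A} {xs : List A} (f : A → ℕ) → x ∈ xs → f x ≤ ∑ xs f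
  term≤∑ f (here refl)           = m≤m+n _ _
  term≤∑ f (there {x = y} x∈xs) = ≤-trans (term≤∑ f x∈xs) (m≤n+m _ (f y))

  length-filter≡∑ : {P : A → Set} (P? : Decidable P) (xs : List A) →
                    length (filter P? xs) ≡ ∑ xs (λ x → 𝟙 (P? x))
  length-filter≡∑ P? []       = refl
  length-filter≡∑ P? (x ∷ xs) with does (P? x)
  ... | true  = cong suc (length-filter≡∑ P? xs)
  ... | false = length-filter≡∑ P? xs

  module _ (_≟_ : DecidableEquality A) where
    open DecMembership _≟_ using (_∈?_)

    ∑-𝟙≟-absent : {a : A} (xs : List A) → All (λ x → ¬ a ≡ x) xs → ∑ xs (λ x → 𝟙 (a ≟ x)) ≡ 0
    ∑-𝟙≟-absent []       []         = refl
    ∑-𝟙≟-absent {a} (x ∷ xs) (a≢x ∷ rest) with a ≟ x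
    ... | yes a≡x = contradiction a≡x a≢x
    ... | no _    = ∑-𝟙≟-absent xs rest

    ∑-𝟙≟≤1 : (a : A) {xs : List A} → Unique xs → ∑ xs (λ x → 𝟙 (a ≟ x)) ≤ 1
    ∑-𝟙≟≤1 a []                  = z≤n
    ∑-𝟙≟≤1 a {x ∷ xs} (x∉ ∷ u) with a ≟ x
    ... | yes refl = ≤-reflexive (cong suc (∑-𝟙≟-absent xs x∉))
    ... | no _     = ∑-𝟙≟≤1 a u

    -- Each element of `l` accounts for at most one term of the sum, as `xs` has no repetitions.
    -- This lets bad sets be kept as plain lists `l`, repetitions allowed.
    ∑-𝟙∈≤length : {xs : List A} → Unique xs → (l : List A) → ∑ xs (λ x → 𝟙 (x ∈? l)) ≤ length l
    ∑-𝟙∈≤length {xs} u []      = ≤-reflexive (trans (∑-const xs 0) (*-zeroʳ (length xs)))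
    ∑-𝟙∈≤length {xs} u (a ∷ l) = begin
      ∑ xs (λ x → 𝟙 (x ∈? (a ∷ l)))               ≤⟨ ∑-mono xs split ⟩
      ∑ xs (λ x → 𝟙 (a ≟ x) + 𝟙 (x ∈? l))         ≡⟨ ∑-+ xs _ _ ⟩
      ∑ xs (λ x → 𝟙 (a ≟ x)) + ∑ xs (λ x → 𝟙 (x ∈? l))
        ≤⟨ +-mono-≤ (∑-𝟙≟≤1 a u) (∑-𝟙∈≤length u l) ⟩
      suc (length l)                               ∎
      where
      open ≤-Reasoning
      split : ∀ x → 𝟙 (x ∈? (a ∷ l)) ≤ 𝟙 (a ≟ x) + 𝟙 (x ∈? l)
      split x = 𝟙≤ (x ∈? (a ∷ l)) λ where
        (here refl) → ≤-trans (1≤𝟙 (a ≟ a) refl) (m≤m+n _ _)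
        (there x∈l) → ≤-trans (1≤𝟙 (x ∈? l) x∈l) (m≤n+m _ _)

  -- Cells, lines and transversals.

  Cell : ℕ → Set
  Cell n = Fin n × Fin n

  -- Rows are tagged true, columns false.
  Line : ℕ → Set
  Line n = Bool × Fin n

  coord : {n : ℕ} → Bool → Cell n → Fin n
  coord true  = proj₁
  coord false = proj₂

  line : {n : ℕ} → Bool → Cell n → Line n
  line b p = b , coord b p

  symbol : {n : ℕ} → Array n → Cell n → Fin n
  symbol L p = L (proj₁ p) (proj₂ p)

  -- Indexing entries by `Fin t` lets an entry keep its identity after being moved to another cell.
  -- The tag `b` handles rows and columns at once.
  record Transversal {n : ℕ} (L : Array n) (t : ℕ) : Set where
    field
      cell       : Fin t → Cell n
      coord-inj  : ∀ b {j k} → coord b (cell j) ≡ coord b (cell k) → j ≡ k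
      symbol-inj : ∀ {j k} → symbol L (cell j) ≡ symbol L (cell k) → j ≡ k

  -- Rearrangements of a transversal.

  module Switching {n t : ℕ} {L : Array n} (T₀ : Transversal L t) where
    open Transversal T₀

    _≟ˡ_ : (ℓ ℓ′ : Line n) → Dec (ℓ ≡ ℓ′)
    _≟ˡ_ = ≡-dec Bool._≟_ _≟_

    _≟ᶜ_ : (p q : Cell n) → Dec (p ≡ q)
    _≟ᶜ_ = ≡-dec _≟_ _≟_

    open DecMembership _≟ˡ_ using () renaming (_∈?_ to _∈ˡ?_)
    open DecMembership _≟ᶜ_ using () renaming (_∈?_ to _∈ᶜ?_)
    open DecMembership (_≟_ {n = t}) using (_∈?_)

    -- Besides the old and new lines of moved indices, touched may hold lines
    -- that are merely reserved.
    record State : Set where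
      field
        pos        : Fin t → Cell n
        touched    : List (Line n)
        pos-inj    : ∀ b {j k} → coord b (pos j) ≡ coord b (pos k) → j ≡ k
        pos-symbol : ∀ k → symbol L (pos k) ≡ symbol L (cell k)
        displaced  : ∀ k → pos k ≡ cell k ⊎
                     (∀ b → line b (pos k) ∈ touched × line b (cell k) ∈ touched)
    open State

    initial : State
    initial = record
      { pos = cell ; touched = [] ; pos-inj = coord-inj
      ; pos-symbol = λ _ → refl ; displaced = λ _ → inj₁ refl }

    -- The lines in `touched S` are protected: a step from `S` moves only indices of `X`, and
    -- neither the lines they leave nor those they enter are touched in `S`.
    record _⊑[_]_ (S : State) (X : List (Fin t)) (S′ : State) : Set where
      field
        touched⊆ : ∀ {ℓ} → ℓ ∈ touched S → ℓ ∈ touched S′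
        moved    : ∀ j → pos S′ j ≡ pos S j ⊎
                   (j ∈ X × ∀ b → line b (pos S j) ∉ touched S × line b (pos S′ j) ∉ touched S)
    open _⊑[_]_

    ⊑-trans : ∀ {X S S′ S″} → S ⊑[ X ] S′ → S′ ⊑[ X ] S″ → S ⊑[ X ] S″
    ⊑-trans {X} {S} {S′} {S″} S⊑S′ S′⊑S″ = record
      { touched⊆ = touched⊆ S′⊑S″ ∘ touched⊆ S⊑S′
      ; moved    = λ j → compose j (moved S⊑S′ j) (moved S′⊑S″ j)
      }
      where
      compose : ∀ j → _ → _ → _
      compose j (inj₁ p) (inj₁ q) = inj₁ (trans q p)
      compose j (inj₁ p) (inj₂ (j∈X , q)) = inj₂ (j∈X , λ b →
        subst (λ c → line b c ∉ touched S) p (proj₁ (q b) ∘ touched⊆ S⊑S′) ,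
        proj₂ (q b) ∘ touched⊆ S⊑S′)
      compose j (inj₂ (j∈X , p)) (inj₁ q) = inj₂ (j∈X , λ b →
        proj₁ (p b) , subst (λ c → line b c ∉ touched S) (sym q) (proj₂ (p b)))
      compose j (inj₂ (j∈X , p)) (inj₂ (_ , q)) = inj₂ (j∈X , λ b →
        proj₁ (p b) , proj₂ (q b) ∘ touched⊆ S⊑S′)

    ⊑-weaken : ∀ {X Y S S′} → (∀ {k} → k ∈ X → k ∈ Y) → S ⊑[ X ] S′ → S ⊑[ Y ] S′
    ⊑-weaken X⊆Y S⊑S′ = record
      { touched⊆ = touched⊆ S⊑S′
      ; moved    = λ j → [ inj₁ , (λ (j∈X , p) → inj₂ (X⊆Y j∈X , p)) ]′ (moved S⊑S′ j)
      }

    Spare : State → Line n → Set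
    Spare S ℓ = ℓ ∈ touched S × ∀ j → line (proj₁ ℓ) (pos S j) ≢ ℓ

    SpareCell : Cell n → State → Set
    SpareCell p S = ∀ b → Spare S (line b p)

    -- An index now on `ℓ` would either have been there already or have moved onto a line of
    -- `touched S`, which `_⊑[_]_` forbids. So a freed line stays free while others are being freed.
    Spare-mono : ∀ {X S S′ ℓ} → S ⊑[ X ] S′ → Spare S ℓ → Spare S′ ℓ
    Spare-mono {S = S} {S′} {ℓ} S⊑S′ (ℓ∈ , unused) = touched⊆ S⊑S′ ℓ∈ , unused′
      where
      unused′ : ∀ j → line (proj₁ ℓ) (pos S′ j) ≢ ℓ
      unused′ j e with moved S⊑S′ j
      ... | inj₁ p       = unused j (trans (cong (line (proj₁ ℓ)) (sym p)) e)
      ... | inj₂ (_ , p) = proj₂ (p (proj₁ ℓ)) (subst (_∈ touched S) (sym e) ℓ∈)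

    -- Freeing indices, lines and cells.

    Freed : List (Fin t) → ℕ → State → (State → Set) → Set
    Freed X K S Q = Σ State λ S′ → S ⊑[ X ] S′ × length (touched S′) ≤ K × Q S′

    -- Uniformly in n, B bounds the number of exceptions and G the touched lines.
    IndexFreeing : List (Fin t) → (B G : ℕ → ℕ) → Set
    IndexFreeing X B G = ∀ K S → length (touched S) ≤ K →
      Σ (List (Fin t)) λ bad → length bad ≤ B K ×
        (∀ k → k ∈ X → k ∉ bad → Freed X (G K) S (SpareCell (cell k)))

    -- For `X` the set Xᵢ these are the lines of Rᵢ and Cᵢ: no entry of the transversal outside `X`
    -- lies on `ℓ`.
    Reach : List (Fin t) → Line n → Set
    Reach X ℓ = ∀ k → k ∈ X ⊎ line (proj₁ ℓ) (cell k) ≢ ℓ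

    Reach? : ∀ X ℓ → Dec (Reach X ℓ)
    Reach? X ℓ = all? λ k → (k ∈? X) ⊎-dec ¬? (line (proj₁ ℓ) (cell k) ≟ˡ ℓ)

    -- `bad` is made to contain `touched S` so that every line outside it is untouched, which
    -- `relocate` requires of the target cell.
    LineFreeing : List (Fin t) → (B G : ℕ → ℕ) → Set
    LineFreeing X B G = ∀ K S → length (touched S) ≤ K →
      Σ (List (Line n)) λ bad → length bad ≤ B K × (∀ {ℓ} → ℓ ∈ touched S → ℓ ∈ bad) ×
        (∀ ℓ → Reach X ℓ → ℓ ∉ bad → Freed X (G K) S (λ S′ → Spare S′ ℓ))

    -- The bound on bad cells carries a factor `n`, since a single bad line can spoil n cells.
    CellFreeing : List (Fin t) → (B G : ℕ → ℕ) → Set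
    CellFreeing X B G = ∀ K S → length (touched S) ≤ K →
      Σ (List (Cell n)) λ bad → length bad ≤ n * B K ×
        (∀ p → (∀ b → Reach X (line b p)) → p ∉ bad →
          (∀ b → line b p ∉ touched S) × Freed X (G K) S (SpareCell p))

    -- An entry on `ℓ` in `S` would sit either at its original cell, which `empty` rules out, or at
    -- a moved one, whose lines are all touched. So `ℓ` is empty, and marking it touched suffices.
    reserve : ∀ X S ℓ → (∀ k → line (proj₁ ℓ) (cell k) ≢ ℓ) → ℓ ∉ touched S →
              Freed X (suc (length (touched S))) S (λ S′ → Spare S′ ℓ)
    reserve X S ℓ empty ℓ∉ = S′ , S⊑S′ , ≤-refl , here refl , unused
      where
      S′ : State
      S′ = record
        { pos = pos S ; touched = ℓ ∷ touched S ; pos-inj = pos-inj S ; pos-symbol = pos-symbol S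
        ; displaced = λ k → [ inj₁ , (λ p → inj₂ λ b → there (proj₁ (p b)) , there (proj₂ (p b))) ]′
                              (displaced S k) }
      S⊑S′ : S ⊑[ X ] S′
      S⊑S′ = record { touched⊆ = there ; moved = λ _ → inj₁ refl }
      unused : ∀ j → line (proj₁ ℓ) (pos S j) ≢ ℓ
      unused j e with displaced S j
      ... | inj₁ p = empty j (trans (cong (line (proj₁ ℓ)) (sym p)) e)
      ... | inj₂ p = ℓ∉ (subst (_∈ touched S) e (proj₁ (p (proj₁ ℓ))))

    -- A reachable line either meets no entry of the original transversal and is reserved, or is a
    -- line of `cell k` with `k` in `X` and is freed together with that cell. The exceptions are the
    -- touched lines and both lines of each bad index.
    freeLine : ∀ {X B G} → IndexFreeing X B G →
               LineFreeing X (λ K → K + (B K + B K)) (λ K → G K + suc K)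
    freeLine {X} {B} {G} free K S |S|≤K with free K S |S|≤K
    ... | bad , |bad|≤ , freeIndex = badLines , bound , ∈-++⁺ˡ , freeℓ
      where
      rows = map (line true ∘ cell) bad
      cols = map (line false ∘ cell) bad
      badLines = touched S ++ (rows ++ cols)

      bound : length badLines ≤ K + (B K + B K)
      bound rewrite length-++ (touched S) {rows ++ cols} | length-++ rows {cols}
                  | length-map (line true ∘ cell) bad | length-map (line false ∘ cell) bad
        = +-mono-≤ |S|≤K (+-mono-≤ |bad|≤ |bad|≤)

      bad-line : ∀ b {k} → k ∈ bad → line b (cell k) ∈ badLines
      bad-line true  k∈ = ∈-++⁺ʳ (touched S) (∈-++⁺ˡ (∈-map⁺ (line true ∘ cell) k∈))
      bad-line false k∈ = ∈-++⁺ʳ (touched S) (∈-++⁺ʳ rows (∈-map⁺ (line false ∘ cell) k∈))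

      freeℓ : ∀ ℓ → Reach X ℓ → ℓ ∉ badLines → Freed X (G K + suc K) S (λ S′ → Spare S′ ℓ)
      freeℓ ℓ reach ℓ∉ with any? (λ k → line (proj₁ ℓ) (cell k) ≟ˡ ℓ)
      ... | no none =
        let S′ , S⊑S′ , |S′| , spare = reserve X S ℓ (λ k e → none (k , e)) (ℓ∉ ∘ ∈-++⁺ˡ)
        in S′ , S⊑S′ , ≤-trans |S′| (≤-trans (s≤s |S|≤K) (m≤n+m _ (G K))) , spare
      ... | yes (k , refl) with reach k
      ...   | inj₂ ≢ℓ = contradiction refl ≢ℓ
      ...   | inj₁ k∈X =
        let S′ , S⊑S′ , |S′| , spare = freeIndex k k∈X (ℓ∉ ∘ bad-line (proj₁ ℓ))
        in S′ , S⊑S′ , ≤-trans |S′| (m≤m+n (G K) _) , spare (proj₁ ℓ)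

    -- The row is freed first, then the column from the resulting state. The bad columns depend on
    -- the row, so the bad cells are whole bad rows, at most `n * B K` cells, plus at most `B (G K)`
    -- cells in each of the n rows.
    freeCell : ∀ {X B G} → LineFreeing X B G →
               CellFreeing X (λ K → B K + B (G K)) (λ K → G (G K))
    freeCell {X} {B} {G} free K S |S|≤K with free K S |S|≤K
    ... | bad , |bad|≤ , touched⊆bad , freeRow = badCells , bound , freeP
      where
      -- With row r already freed, the columns that can no longer be freed.
      BadCols : Fin n → List (Line n) → Set
      BadCols r cols = Reach X (true , r) → (true , r) ∉ bad → ∀ c → Reach X (false , c) →
        (false , c) ∉ cols → (false , c) ∉ touched S × Freed X (G (G K)) S (SpareCell (r , c))

      badCols : ∀ r → Σ (List (Line n)) λ cols → length cols ≤ B (G K) × BadCols r cols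
      badCols r with Reach? X (true , r) | (true , r) ∈ˡ? bad
      ... | no ¬reach | _ = [] , z≤n , λ reach → contradiction reach ¬reach
      ... | yes _     | yes r∈ = [] , z≤n , λ _ r∉ → contradiction r∈ r∉
      ... | yes reach | no r∉ with freeRow (true , r) reach r∉
      ...   | S₁ , S⊑S₁ , |S₁| , spare-r with free (G K) S₁ |S₁|
      ...     | cols , |cols| , touched⊆cols , freeCol = cols , |cols| , λ _ _ c reach-c c∉ →
        let S₂ , S₁⊑S₂ , |S₂| , spare-c = freeCol (false , c) reach-c c∉
            -- The row stays spare while the column is freed, because it is touched in `S₁`.
            spare : SpareCell (r , c) S₂
            spare = λ { true → Spare-mono S₁⊑S₂ spare-r ; false → spare-c }
        in c∉ ∘ touched⊆cols ∘ touched⊆ S⊑S₁ , S₂ , ⊑-trans S⊑S₁ S₁⊑S₂ , |S₂| , spare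

      inRow : Fin n → List (Cell n)
      inRow r = map (λ ℓ → r , proj₂ ℓ) (proj₁ (badCols r))

      badCells = cartesianProduct (map proj₂ bad) (allFin n) ++ concatMap inRow (allFin n)

      bound : length badCells ≤ n * (B K + B (G K))
      bound = begin
        length badCells
          ≡⟨ length-++ (cartesianProduct (map proj₂ bad) (allFin n)) ⟩
        length (cartesianProduct (map proj₂ bad) (allFin n)) + length (concatMap inRow (allFin n))
          ≤⟨ +-mono-≤ (≤-reflexive (length-cartesianProduct (map proj₂ bad) (allFin n)))
                      (length-concatMap≤ inRow (B (G K)) (allFin n) λ r →
                        ≤-trans (≤-reflexive (length-map _ (proj₁ (badCols r))))
                                (proj₁ (proj₂ (badCols r)))) ⟩
        length (map proj₂ bad) * length (allFin n) + length (allFin n) * B (G K)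
          ≡⟨ cong₂ (λ a b → a * b + b * B (G K)) (length-map proj₂ bad) (length-allFin n) ⟩
        length bad * n + n * B (G K)
          ≤⟨ +-monoˡ-≤ (n * B (G K)) (*-monoˡ-≤ n |bad|≤) ⟩
        B K * n + n * B (G K)
          ≡⟨ cong (_+ n * B (G K)) (*-comm (B K) n) ⟩
        n * B K + n * B (G K)
          ≡⟨ *-distribˡ-+ n (B K) (B (G K)) ⟨
        n * (B K + B (G K)) ∎
        where open ≤-Reasoning

      freeP : ∀ p → (∀ b → Reach X (line b p)) → p ∉ badCells →
              (∀ b → line b p ∉ touched S) × Freed X (G (G K)) S (SpareCell p)
      freeP (r , c) reach p∉ =
        let r∉ : (true , r) ∉ bad
            r∉ r∈ = p∉ (∈-++⁺ˡ (∈-cartesianProduct⁺ (∈-map⁺ proj₂ r∈) (∈-allFin c)))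
            c∉ : (false , c) ∉ proj₁ (badCols r)
            c∉ c∈ = p∉ (∈-++⁺ʳ (cartesianProduct (map proj₂ bad) (allFin n))
              (∈-concatMap⁺ inRow (lose (∈-allFin r) (∈-map⁺ (λ ℓ → r , proj₂ ℓ) c∈))))
            c∉S , freed = proj₂ (proj₂ (badCols r)) (reach true) r∉ c (reach false) c∉
        in (λ { true → r∉ ∘ touched⊆bad ; false → c∉S }) , freed

    -- Once the two lines of `p` are empty, entry `k` moves to `p` and vacates its own row and
    -- column. The cost 2 pays for marking those two lines touched; the lines of `p`, being spare,
    -- are touched already.
    relocate : ∀ {X Y S K p k} → (∀ {j} → j ∈ X → j ∈ Y) → k ∈ Y → k ∉ X →
      symbol L p ≡ symbol L (cell k) → (∀ b → line b (cell k) ∉ touched S) →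
      (∀ b → line b p ∉ touched S) → Freed X K S (SpareCell p) →
      Freed Y (2 + K) S (SpareCell (cell k))
    relocate {X} {Y} {S} {K} {p} {k} X⊆Y k∈Y k∉X symbol-p k∉S p∉S (S₁ , S⊑S₁ , |S₁| , spare) =
      S′ , S⊑S′ , s≤s (s≤s |S₁|) , λ b → cell-touched b , cell-unused b
      where
      -- An index away from its original cell has its original lines touched, which `k∉S` excludes.
      pos-k : pos S k ≡ cell k
      pos-k with displaced S k
      ... | inj₁ e = e
      ... | inj₂ t = contradiction (proj₂ (t true)) (k∉S true)

      -- Freeing `p` moved only indices of `X`, so `k` is still in place.
      pos₁-k : pos S₁ k ≡ cell k
      pos₁-k with moved S⊑S₁ k
      ... | inj₁ e         = trans e pos-k
      ... | inj₂ (k∈X , _) = contradiction k∈X k∉X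

      pos′ : Fin t → Cell n
      pos′ = updateAt (pos S₁) k (const p)

      at-k : pos′ k ≡ p
      at-k = updateAt-updates k (pos S₁)

      off-k : ∀ {j} → j ≢ k → pos′ j ≡ pos S₁ j
      off-k {j} = updateAt-minimal j k (pos S₁)

      touched′ = line true (cell k) ∷ line false (cell k) ∷ touched S₁

      cell-touched : ∀ b → line b (cell k) ∈ touched′
      cell-touched true  = here refl
      cell-touched false = there (here refl)

      away-from-p : ∀ b j → coord b (pos S₁ j) ≢ coord b p
      away-from-p b j e = proj₂ (spare b) j (cong (b ,_) e)

      S′ : State
      S′ = record
        { pos = pos′ ; touched = touched′ ; pos-inj = inj ; pos-symbol = same-symbol ; displaced = disp }
        where
        inj : ∀ b {i j} → coord b (pos′ i) ≡ coord b (pos′ j) → i ≡ j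
        inj b {i} {j} e with i ≟ k | j ≟ k
        ... | yes i≡k  | yes j≡k  = trans i≡k (sym j≡k)
        ... | yes refl | no j≢k   = contradiction
          (trans (cong (coord b) (sym (off-k j≢k))) (trans (sym e) (cong (coord b) at-k))) (away-from-p b j)
        ... | no i≢k   | yes refl = contradiction
          (trans (cong (coord b) (sym (off-k i≢k))) (trans e (cong (coord b) at-k))) (away-from-p b i)
        ... | no i≢k   | no j≢k   = pos-inj S₁ b
          (trans (cong (coord b) (sym (off-k i≢k))) (trans e (cong (coord b) (off-k j≢k))))

        same-symbol : ∀ j → symbol L (pos′ j) ≡ symbol L (cell j)
        same-symbol j with j ≟ k
        ... | yes refl = trans (cong (symbol L) at-k) symbol-p
        ... | no j≢k   = trans (cong (symbol L) (off-k j≢k)) (pos-symbol S₁ j)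

        disp : ∀ j → pos′ j ≡ cell j ⊎ (∀ b → line b (pos′ j) ∈ touched′ × line b (cell j) ∈ touched′)
        disp j with j ≟ k
        ... | yes refl = inj₂ λ b →
          subst (λ c → line b c ∈ touched′) (sym at-k) (there (there (proj₁ (spare b)))) , cell-touched b
        ... | no j≢k with displaced S₁ j
        ...   | inj₁ e = inj₁ (trans (off-k j≢k) e)
        ...   | inj₂ t = inj₂ λ b →
          subst (λ c → line b c ∈ touched′) (sym (off-k j≢k)) (there (there (proj₁ (t b)))) ,
          there (there (proj₂ (t b)))

      S⊑S′ : S ⊑[ Y ] S′
      S⊑S′ = record { touched⊆ = there ∘ there ∘ touched⊆ S⊑S₁ ; moved = mv }
        where
        mv : ∀ j → _
        mv j with j ≟ k
        ... | yes refl = inj₂ (k∈Y , λ b →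
          subst (λ c → line b c ∉ touched S) (sym pos-k) (k∉S b) ,
          subst (λ c → line b c ∉ touched S) (sym at-k) (p∉S b))
        ... | no j≢k with moved (⊑-weaken X⊆Y S⊑S₁) j
        ...   | inj₁ e         = inj₁ (trans (off-k j≢k) e)
        ...   | inj₂ (j∈Y , t) = inj₂ (j∈Y , λ b →
          proj₁ (t b) , subst (λ c → line b c ∉ touched S) (sym (off-k j≢k)) (proj₂ (t b)))

      cell-unused : ∀ b j → line b (pos′ j) ≢ line b (cell k)
      cell-unused b j e with j ≟ k
      -- Entry `k` is now at `p`, whose lines avoid `cell k`: it was still at `cell k` in `S₁`, when
      -- the lines of `p` were already empty.
      ... | yes refl = away-from-p b k
        (trans (cong (coord b) pos₁-k) (trans (sym (proj₂ (,-injective e))) (cong (coord b) at-k)))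
      ... | no j≢k   = j≢k (pos-inj S₁ b
        (trans (cong (coord b) (sym (off-k j≢k)))
          (trans (proj₂ (,-injective e)) (cong (coord b) (sym pos₁-k)))))

    -- Copies of symbols and the passage to the next stage.

    cells! : Unique (cells n)
    cells! = Unique.cartesianProduct⁺ (Unique.allFin⁺ n) (Unique.allFin⁺ n)

    ∈-cells : ∀ p → p ∈ cells n
    ∈-cells (r , c) = ∈-cartesianProduct⁺ (∈-allFin r) (∈-allFin c)

    copies : (Cell n → ℕ) → Fin t → ℕ
    copies w k = ∑ (cells n) λ p → w p * 𝟙 (symbol L p ≟ symbol L (cell k))

    ∑-copies : ∀ w → ∑ (allFin t) (copies w) ≡
      ∑ (cells n) λ p → w p * ∑ (allFin t) λ k → 𝟙 (symbol L p ≟ symbol L (cell k))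
    ∑-copies w = trans (∑-swap (allFin t) (cells n) _)
                       (∑-cong (cells n) λ p → ∑-*ˡ (allFin t) (w p) _)

    -- Distinct entries of the transversal carry distinct symbols, so each cell is a copy for at
    -- most one index.
    ∑-copies≤ : ∀ w → ∑ (allFin t) (copies w) ≤ ∑ (cells n) w
    ∑-copies≤ w = ≤-trans (≤-reflexive (∑-copies w)) (∑-mono (cells n) λ p →
      ≤-trans (*-monoʳ-≤ (w p) (begin
        ∑ (allFin t) (λ k → 𝟙 (symbol L p ≟ symbol L (cell k)))
          ≡⟨ ∑-map (symbol L ∘ cell) (allFin t) _ ⟨
        ∑ (map (symbol L ∘ cell) (allFin t)) (λ s → 𝟙 (symbol L p ≟ s))
          ≤⟨ ∑-𝟙≟≤1 _≟_ (symbol L p) (Unique.map⁺ symbol-inj (Unique.allFin⁺ t)) ⟩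
        1 ∎)) (≤-reflexive (*-identityʳ (w p))))
      where open ≤-Reasoning

    Grid? : ∀ X p → Dec (Reach X (line true p) × Reach X (line false p))
    Grid? X p = Reach? X (line true p) ×-dec Reach? X (line false p)

    gridCopies : List (Fin t) → Fin t → ℕ
    gridCopies X = copies λ p → 𝟙 (Grid? X p)

    Abundant? : ∀ M X k → Dec (k ∈ X ⊎ M ≤ gridCopies X k)
    Abundant? M X k = (k ∈? X) ⊎-dec (M ≤? gridCopies X k)

    -- With `M` = g this turns Xᵢ into Xᵢ₊₁.
    expand : ℕ → List (Fin t) → List (Fin t)
    expand M X = filter (Abundant? M X) (allFin t)

    module _ {M Q : ℕ} {X : List (Fin t)} {B G B′ G′ : ℕ → ℕ} .{{_ : NonZero M}} (n≤QM : n ≤ Q * M)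
             (freeIndex : IndexFreeing X B G) (freeP : CellFreeing X B′ G′) where

      -- An index of `X` is freed as before. Any other has a copy in the grid on a freeable cell,
      -- and `relocate` moves it there. The exceptions are the old ones, the indices with at least
      -- `M` copies among the bad cells, and those whose own row or column is touched.
      freeIndex-expand : IndexFreeing (expand M X) (λ K → B K + (Q * B′ K + (K + K)))
                                      (λ K → G K + (2 + G′ K))
      freeIndex-expand K S |S|≤K with freeIndex K S |S|≤K | freeP K S |S|≤K
      ... | badX , |badX| , freeX | badCells , |badCells| , free = bad , bound , freed
        where
        badCopies : Fin t → ℕ
        badCopies = copies λ p → 𝟙 (p ∈ᶜ? badCells)

        stuck? = λ k → M ≤? badCopies k
        hit?   = λ b k → line b (cell k) ∈ˡ? touched S

        stuck = filter stuck? (allFin t)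
        hit   = λ b → filter (hit? b) (allFin t)
        bad   = badX ++ (stuck ++ (hit true ++ hit false))

        -- Each stuck index owns `M` of the at most `n * B′ K` bad cells, and no cell is counted
        -- twice. By `n ≤ Q * M` the number of stuck indices is bounded without reference to n.
        |stuck| : length stuck ≤ Q * B′ K
        |stuck| = *-cancelʳ-≤ (length stuck) (Q * B′ K) M (begin
          length stuck * M                           ≡⟨ *-comm (length stuck) M ⟩
          M * length stuck                           ≡⟨ cong (M *_) (length-filter≡∑ stuck? (allFin t)) ⟩
          M * ∑ (allFin t) (λ k → 𝟙 (stuck? k))      ≡⟨ ∑-*ˡ (allFin t) M _ ⟨
          ∑ (allFin t) (λ k → M * 𝟙 (stuck? k))      ≤⟨ ∑-mono (allFin t) per-index ⟩
          ∑ (allFin t) badCopies                     ≤⟨ ∑-copies≤ _ ⟩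
          ∑ (cells n) (λ p → 𝟙 (p ∈ᶜ? badCells))     ≤⟨ ∑-𝟙∈≤length _≟ᶜ_ cells! badCells ⟩
          length badCells                            ≤⟨ |badCells| ⟩
          n * B′ K                                   ≤⟨ *-monoˡ-≤ (B′ K) n≤QM ⟩
          Q * M * B′ K                               ≡⟨ rearrange Q M (B′ K) ⟩
          Q * B′ K * M                               ∎)
          where
          open ≤-Reasoning
          rearrange : ∀ a b c → a * b * c ≡ a * c * b
          rearrange = solve-∀
          per-index : ∀ k → M * 𝟙 (stuck? k) ≤ badCopies k
          per-index k = *𝟙≤ (stuck? k) λ M≤ → M≤

        |hit| : ∀ b → length (hit b) ≤ K
        |hit| b = begin
          length (hit b)                                      ≡⟨ length-filter≡∑ (hit? b) (allFin t) ⟩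
          ∑ (allFin t) (λ k → 𝟙 (hit? b k))                   ≡⟨ ∑-map (line b ∘ cell) (allFin t) _ ⟨
          ∑ (map (line b ∘ cell) (allFin t)) (λ ℓ → 𝟙 (ℓ ∈ˡ? touched S))
            ≤⟨ ∑-𝟙∈≤length _≟ˡ_
                 (Unique.map⁺ (λ e → coord-inj b (proj₂ (,-injective e))) (Unique.allFin⁺ t)) (touched S) ⟩
          length (touched S)                                  ≤⟨ |S|≤K ⟩
          K                                                   ∎
          where open ≤-Reasoning

        bound : length bad ≤ B K + (Q * B′ K + (K + K))
        bound rewrite length-++ badX {stuck ++ (hit true ++ hit false)}
                    | length-++ stuck {hit true ++ hit false} | length-++ (hit true) {hit false}
          = +-mono-≤ |badX| (+-mono-≤ |stuck| (+-mono-≤ (|hit| true) (|hit| false)))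

        hit-bad : ∀ b {k} → line b (cell k) ∈ touched S → k ∈ bad
        hit-bad true  {k} k∈ = ∈-++⁺ʳ badX (∈-++⁺ʳ stuck (∈-++⁺ˡ (∈-filter⁺ (hit? true) (∈-allFin k) k∈)))
        hit-bad false {k} k∈ =
          ∈-++⁺ʳ badX (∈-++⁺ʳ stuck (∈-++⁺ʳ (hit true) (∈-filter⁺ (hit? false) (∈-allFin k) k∈)))

        X⊆ : ∀ {k} → k ∈ X → k ∈ expand M X
        X⊆ {k} k∈X = ∈-filter⁺ (Abundant? M X) (∈-allFin k) (inj₁ k∈X)

        Usable? : ∀ k p → Dec ((Reach X (line true p) × Reach X (line false p)) ×
                               (p ∉ badCells × symbol L p ≡ symbol L (cell k)))
        Usable? k p = Grid? X p ×-dec (¬? (p ∈ᶜ? badCells) ×-dec (symbol L p ≟ symbol L (cell k)))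

        usable : ∀ k → M ≤ gridCopies X k → ¬ M ≤ badCopies k →
          ∃ λ p → (Reach X (line true p) × Reach X (line false p)) ×
                  (p ∉ badCells × symbol L p ≡ symbol L (cell k))
        usable k M≤ M≰ with Any.any? (Usable? k) (cells n)
        ... | yes found = Any.satisfied found
        -- If every grid copy were bad, `badCopies k` would be at least `gridCopies X k`, hence at
        -- least `M`.
        ... | no none   = contradiction (≤-trans M≤ (∑-mono (cells n) λ p →
                𝟙*𝟙≤𝟙*𝟙 (Grid? X p) (p ∈ᶜ? badCells) (symbol L p ≟ symbol L (cell k)) (covered p))) M≰
          where
          covered : ∀ p → Reach X (line true p) × Reach X (line false p) →
                    symbol L p ≡ symbol L (cell k) → p ∈ badCells
          covered p reach same with p ∈ᶜ? badCells
          ... | yes p∈ = p∈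
          ... | no p∉  = contradiction (lose (∈-cells p) (reach , p∉ , same)) none

        freed : ∀ k → k ∈ expand M X → k ∉ bad →
                Freed (expand M X) (G K + (2 + G′ K)) S (SpareCell (cell k))
        freed k k∈ k∉bad with k ∈? X | proj₂ (∈-filter⁻ (Abundant? M X) {xs = allFin t} k∈)
        ... | no k∉X | inj₁ k∈X = contradiction k∈X k∉X
        ... | yes k∈X | _ =
          let S′ , S⊑S′ , |S′| , spare = freeX k k∈X (k∉bad ∘ ∈-++⁺ˡ)
          in S′ , ⊑-weaken X⊆ S⊑S′ , ≤-trans |S′| (m≤m+n (G K) _) , spare
        ... | no k∉X | inj₂ M≤ =
          let p , (reach-r , reach-c) , p∉ , same = usable k M≤ λ M≤′ →
                k∉bad (∈-++⁺ʳ badX (∈-++⁺ˡ (∈-filter⁺ stuck? (∈-allFin k) M≤′)))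
              p∉S , freed-p = free p (λ { true → reach-r ; false → reach-c }) p∉
              S′ , S⊑S′ , |S′| , spare =
                relocate X⊆ k∈ k∉X same (λ b → k∉bad ∘ hit-bad b) p∉S freed-p
          in S′ , S⊑S′ , ≤-trans |S′| (m≤n+m _ (G K)) , spare

    -- Sizes of the stages and of their grids.

    size : List (Fin t) → ℕ
    size X = ∑ (allFin t) λ k → 𝟙 (k ∈? X)

    size≤t : ∀ X → size X ≤ t
    size≤t X = begin
      size X                  ≤⟨ ∑-mono (allFin t) (λ k → 𝟙≤ (k ∈? X) λ _ → ≤-refl) ⟩
      ∑ (allFin t) (λ _ → 1)  ≡⟨ ∑-const (allFin t) 1 ⟩
      length (allFin t) * 1   ≡⟨ *-identityʳ _ ⟩
      length (allFin t)       ≡⟨ length-allFin t ⟩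
      t                       ∎
      where open ≤-Reasoning

    reachable : Bool → List (Fin t) → ℕ
    reachable b X = ∑ (allFin n) λ x → 𝟙 (Reach? X (b , x))

    -- Each unreachable line carries an entry with index outside `X`, and each such entry lies on a
    -- single line of kind `b`. So at most `t - size X` of the n lines are unreachable.
    reachable-size : ∀ b X → n + size X ≤ reachable b X + t
    reachable-size b X = begin
      n + size X
        ≡⟨ cong (_+ size X) (trans (∑-const (allFin n) 1) (trans (*-identityʳ _) (length-allFin n))) ⟨
      ∑ (allFin n) (λ _ → 1) + size X
        ≤⟨ +-monoˡ-≤ (size X) (∑-mono (allFin n) cover) ⟩
      ∑ (allFin n) (λ x → 𝟙 (Reach? X (b , x)) + ∑ (allFin t) (blocks x)) + size X
        ≡⟨ cong (_+ size X) (∑-+ (allFin n) _ _) ⟩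
      reachable b X + ∑ (allFin n) (λ x → ∑ (allFin t) (blocks x)) + size X
        ≡⟨ cong (λ m → reachable b X + m + size X) (∑-swap (allFin n) (allFin t) blocks) ⟩
      reachable b X + ∑ (allFin t) (λ k → ∑ (allFin n) (λ x → blocks x k)) + size X
        ≡⟨ +-assoc (reachable b X) _ _ ⟩
      reachable b X + (∑ (allFin t) (λ k → ∑ (allFin n) (λ x → blocks x k)) + size X)
        ≡⟨ cong (reachable b X +_) (∑-+ (allFin t) _ _) ⟨
      reachable b X + ∑ (allFin t) (λ k → ∑ (allFin n) (λ x → blocks x k) + 𝟙 (k ∈? X))
        ≤⟨ +-monoʳ-≤ (reachable b X) (∑-mono (allFin t) once) ⟩
      reachable b X + ∑ (allFin t) (λ _ → 1)
        ≡⟨ cong (reachable b X +_) (trans (∑-const (allFin t) 1) (trans (*-identityʳ _) (length-allFin t))) ⟩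
      reachable b X + t ∎
      where
      open ≤-Reasoning
      blocks : Fin n → Fin t → ℕ
      blocks x k = 𝟙 (¬? (k ∈? X)) * 𝟙 (coord b (cell k) ≟ x)

      cover : ∀ x → 1 ≤ 𝟙 (Reach? X (b , x)) + ∑ (allFin t) (blocks x)
      cover x with any? (λ k → ¬? (k ∈? X) ×-dec (coord b (cell k) ≟ x))
      ... | yes (k , k∉X , e) = ≤-trans
        (≤-trans (*-mono-≤ (1≤𝟙 (¬? (k ∈? X)) k∉X) (1≤𝟙 (coord b (cell k) ≟ x) e))
                 (term≤∑ (blocks x) (∈-allFin k)))
        (m≤n+m _ (𝟙 (Reach? X (b , x))))
      ... | no none = ≤-trans (1≤𝟙 (Reach? X (b , x)) reach) (m≤m+n _ _)
        where
        reach : Reach X (b , x)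
        reach k with k ∈? X
        ... | yes k∈X = inj₁ k∈X
        ... | no k∉X  = inj₂ λ e → none (k , k∉X , proj₂ (,-injective e))

      once : ∀ k → ∑ (allFin n) (λ x → blocks x k) + 𝟙 (k ∈? X) ≤ 1
      once k = ≤-trans (+-monoˡ-≤ (𝟙 (k ∈? X)) (≤-trans
          (≤-reflexive (∑-*ˡ (allFin n) (𝟙 (¬? (k ∈? X))) _))
          (*-monoʳ-≤ (𝟙 (¬? (k ∈? X))) (∑-𝟙≟≤1 _≟_ (coord b (cell k)) (Unique.allFin⁺ n)))))
        (complement (k ∈? X))
        where
        complement : ∀ {P : Set} (d : Dec P) → 𝟙 (¬? d) * 1 + 𝟙 d ≤ 1
        complement (yes _) = ≤-refl
        complement (no _)  = ≤-refl

    -- Enlarging the transversal by a new symbol.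

    extend : ∀ {X K p} → Freed X K initial (SpareCell p) →
             (∀ k → symbol L p ≢ symbol L (cell k)) → Transversal L (suc t)
    extend {p = p} (S , _ , _ , spare) new = record
      { cell = cell′ ; coord-inj = inj ; symbol-inj = sym-inj }
      where
      cell′ : Fin (suc t) → Cell n
      cell′ zero    = p
      cell′ (suc k) = pos S k

      inj : ∀ b {j k} → coord b (cell′ j) ≡ coord b (cell′ k) → j ≡ k
      inj b {zero}  {zero}  e = refl
      inj b {zero}  {suc k} e = contradiction (cong (b ,_) (sym e)) (proj₂ (spare b) k)
      inj b {suc j} {zero}  e = contradiction (cong (b ,_) e) (proj₂ (spare b) j)
      inj b {suc j} {suc k} e = cong suc (pos-inj S b e)

      sym-inj : ∀ {j k} → symbol L (cell′ j) ≡ symbol L (cell′ k) → j ≡ k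
      sym-inj {zero}  {zero}  e = refl
      -- Moved entries keep their symbols, so `new`, stated for the original cells, still applies.
      sym-inj {zero}  {suc k} e = contradiction (trans e (pos-symbol S k)) (new k)
      sym-inj {suc j} {zero}  e = contradiction (trans (sym e) (pos-symbol S j)) (new j)
      sym-inj {suc j} {suc k} e =
        cong suc (symbol-inj (trans (sym (pos-symbol S j)) (trans e (pos-symbol S k))))

    -- The equi condition enters here: a symbol has only n copies in the whole array.
    gridCopies≤n : IsEquiSquare L → ∀ X k → gridCopies X k ≤ n
    gridCopies≤n equi X k = begin
      gridCopies X k
        ≤⟨ ∑-mono (cells n) (λ p → *-monoˡ-≤ (𝟙 (symbol L p ≟ symbol L (cell k)))
                                    (𝟙≤ (Grid? X p) {1} λ _ → ≤-refl)) ⟩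
      ∑ (cells n) (λ p → 1 * 𝟙 (symbol L p ≟ symbol L (cell k)))
        ≡⟨ ∑-cong (cells n) (λ p → *-identityˡ _) ⟩
      ∑ (cells n) (λ p → 𝟙 (symbol L p ≟ symbol L (cell k)))
        ≡⟨ length-filter≡∑ (λ p → symbol L p ≟ symbol L (cell k)) (cells n) ⟨
      occurrences L (symbol L (cell k))
        ≡⟨ equi (symbol L (cell k)) ⟩
      n ∎
      where open ≤-Reasoning

    reachable-product : ∀ X → ∑ (cells n) (λ p → 𝟙 (Grid? X p)) ≡ reachable true X * reachable false X
    reachable-product X = trans
      (∑-cong (cells n) λ p → 𝟙-× (Reach? X (line true p)) (Reach? X (line false p)))
      (∑-cartesianProduct (allFin n) (allFin n) _ _)

    -- Unless a freeable grid cell has a new symbol, every grid cell is bad or a copy of some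
    -- entry's symbol. Indices of the next stage account for at most n cells each, the others for at
    -- most `M` each.
    grid-bound : IsEquiSquare L → ∀ M {X B G} → CellFreeing X B G → Transversal L (suc t) ⊎
      reachable true X * reachable false X ≤ n * B 0 + (n * size (expand M X) + t * M)
    -- Nothing is protected at the start, hence the argument 0.
    grid-bound equi M {X} {B} free with free 0 initial z≤n
    ... | bad , |bad| , freeP with Any.any? fresh? (cells n)
      where
      fresh? = λ p → Grid? X p ×-dec (¬? (p ∈ᶜ? bad) ×-dec all? λ k → ¬? (symbol L p ≟ symbol L (cell k)))
    ...   | yes found =
      let p , (reach-r , reach-c) , p∉ , new = Any.satisfied found
      in inj₁ (extend (proj₂ (freeP p (λ { true → reach-r ; false → reach-c }) p∉)) new)
    ...   | no none = inj₂ (begin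
      reachable true X * reachable false X
        ≡⟨ reachable-product X ⟨
      ∑ (cells n) grid
        ≤⟨ ∑-mono (cells n) cover ⟩
      ∑ (cells n) (λ p → 𝟙 (p ∈ᶜ? bad) + grid p * ∑ (allFin t) (λ k → 𝟙 (symbol L p ≟ symbol L (cell k))))
        ≡⟨ ∑-+ (cells n) _ _ ⟩
      ∑ (cells n) (λ p → 𝟙 (p ∈ᶜ? bad)) + _
        ≡⟨ cong (∑ (cells n) (λ p → 𝟙 (p ∈ᶜ? bad)) +_) (∑-copies grid) ⟨
      ∑ (cells n) (λ p → 𝟙 (p ∈ᶜ? bad)) + ∑ (allFin t) (gridCopies X)
        ≤⟨ +-mono-≤ (≤-trans (∑-𝟙∈≤length _≟ᶜ_ cells! bad) |bad|) (∑-mono (allFin t) per-index) ⟩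
      n * B 0 + ∑ (allFin t) (λ k → n * 𝟙 (k ∈? expand M X) + M)
        ≡⟨ cong (n * B 0 +_) (∑-+ (allFin t) _ _) ⟩
      n * B 0 + (∑ (allFin t) (λ k → n * 𝟙 (k ∈? expand M X)) + ∑ (allFin t) (λ _ → M))
        ≡⟨ cong (n * B 0 +_) (cong₂ _+_ (∑-*ˡ (allFin t) n _)
             (trans (∑-const (allFin t) M) (cong (_* M) (length-allFin t)))) ⟩
      n * B 0 + (n * size (expand M X) + t * M) ∎)
      where
      open ≤-Reasoning
      grid = λ p → 𝟙 (Grid? X p)

      cover : ∀ p → grid p ≤ 𝟙 (p ∈ᶜ? bad) + grid p * ∑ (allFin t) (λ k → 𝟙 (symbol L p ≟ symbol L (cell k)))
      cover p = 𝟙≤ (Grid? X p) λ reach → helper reach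
        where
        helper : _ → _
        helper reach with p ∈ᶜ? bad | any? (λ k → symbol L p ≟ symbol L (cell k))
        ... | yes p∈ | _ = ≤-trans (1≤𝟙 (p ∈ᶜ? bad) p∈) (m≤m+n _ _)
        ... | no _   | yes (k , e) = ≤-trans
          (*-mono-≤ (1≤𝟙 (Grid? X p) reach)
            (≤-trans (1≤𝟙 (symbol L p ≟ symbol L (cell k)) e) (term≤∑ _ (∈-allFin k))))
          (m≤n+m _ (𝟙 (p ∈ᶜ? bad)))
        ... | no p∉  | no ¬e =
          contradiction (lose (∈-cells p) (reach , p∉ , λ k e → ¬e (k , e))) none

      per-index : ∀ k → gridCopies X k ≤ n * 𝟙 (k ∈? expand M X) + M
      per-index k with ≤-total M (gridCopies X k)
      ... | inj₂ ≤M = ≤-trans ≤M (m≤n+m M _)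
      ... | inj₁ M≤ = begin
        gridCopies X k                   ≤⟨ gridCopies≤n equi X k ⟩
        n                                ≡⟨ *-identityʳ n ⟨
        n * 1
          ≤⟨ *-monoʳ-≤ n (1≤𝟙 (k ∈? expand M X)
               (∈-filter⁺ (Abundant? M X) (∈-allFin k) (inj₂ M≤))) ⟩
        n * 𝟙 (k ∈? expand M X)          ≤⟨ m≤m+n _ M ⟩
        n * 𝟙 (k ∈? expand M X) + M      ∎

  -- The quadratic inequality behind the growth of the stages.

  4ab≤[a+b]² : ∀ a b → 4 * (a * b) ≤ (a + b) * (a + b)
  4ab≤[a+b]² a b with ≤-total a b
  -- With the larger number written as the smaller plus `c`, the two sides differ by `c * c`.
  ... | inj₁ a≤b with m≤n⇒∃[o]m+o≡n a≤b
  ...   | c , refl = ≤-trans (m≤m+n _ (c * c)) (≤-reflexive (square a c))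
    where
    square : ∀ a c → 4 * (a * (a + c)) + c * c ≡ (a + (a + c)) * (a + (a + c))
    square = solve-∀
  4ab≤[a+b]² a b | inj₂ b≤a with m≤n⇒∃[o]m+o≡n b≤a
  ...   | c , refl = ≤-trans (m≤m+n _ (c * c)) (≤-reflexive (square b c))
    where
    square : ∀ b c → 4 * ((b + c) * b) + c * c ≡ ((b + c) + b) * ((b + c) + b)
    square = solve-∀

  -- (n - t + x)² ≥ n x + 3 g n as soon as n - t ≥ n/4 + 6 g; the left-hand side is
  -- a lower bound for y₁ y₂.
  growth : ∀ {n t g x x′ b y₁ y₂} .{{_ : NonZero n}} → 4 * t + 24 * g ≤ 3 * n → t ≤ n → b ≤ g →
    n + x ≤ y₁ + t → n + x ≤ y₂ + t → y₁ * y₂ ≤ n * b + (n * x′ + t * g) → x + g ≤ x′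
  growth {n} {t} {g} {x} {x′} {b} {y₁} {y₂} small t≤n b≤g large₁ large₂ product =
    +-cancelʳ-≤ (2 * g) (x + g) x′ (*-cancelˡ-≤ n (*-cancelˡ-≤ 16 (begin
      16 * (n * (x + g + 2 * g))
        ≡⟨ expand₁ n x g ⟩
      4 * (n * (4 * x)) + 48 * g * n
        -- AM-GM for n and 4x. This is the source of 3/4: n/4 is the least c with (c + x)² ≥ n x for
        -- every x.
        ≤⟨ +-monoˡ-≤ (48 * g * n) (4ab≤[a+b]² n (4 * x)) ⟩
      (n + 4 * x) * (n + 4 * x) + 48 * g * n
        ≤⟨ m≤m+n _ (48 * g * (4 * x) + 576 * (g * g)) ⟩
      (n + 4 * x) * (n + 4 * x) + 48 * g * n + (48 * g * (4 * x) + 576 * (g * g))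
        ≡⟨ expand₂ n x g ⟩
      (n + 4 * x + 24 * g) * (n + 4 * x + 24 * g)
        ≤⟨ *-mono-≤ (4y≥ large₁) (4y≥ large₂) ⟩
      4 * y₁ * (4 * y₂)
        ≡⟨ expand₃ y₁ y₂ ⟩
      16 * (y₁ * y₂)
        ≤⟨ *-monoʳ-≤ 16 product ⟩
      16 * (n * b + (n * x′ + t * g))
        -- One `n * g` absorbs the bad cells, another the symbols with at most `g` copies in the
        -- grid. Of the surplus `3 * g`, one `g` is left as the gain.
        ≤⟨ *-monoʳ-≤ 16 (+-mono-≤ (*-monoʳ-≤ n b≤g) (+-monoʳ-≤ (n * x′) (*-monoˡ-≤ g t≤n))) ⟩
      16 * (n * g + (n * x′ + n * g))
        ≡⟨ expand₄ n x′ g ⟩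
      16 * (n * (x′ + 2 * g)) ∎)))
    where
    open ≤-Reasoning
    expand₁ : ∀ n x g → 16 * (n * (x + g + 2 * g)) ≡ 4 * (n * (4 * x)) + 48 * g * n
    expand₁ = solve-∀
    expand₂ : ∀ n x g → (n + 4 * x) * (n + 4 * x) + 48 * g * n + (48 * g * (4 * x) + 576 * (g * g))
                      ≡ (n + 4 * x + 24 * g) * (n + 4 * x + 24 * g)
    expand₂ = solve-∀
    expand₃ : ∀ a b → 4 * a * (4 * b) ≡ 16 * (a * b)
    expand₃ = solve-∀
    expand₄ : ∀ n x g → 16 * (n * g + (n * x + n * g)) ≡ 16 * (n * (x + 2 * g))
    expand₄ = solve-∀
    regroup₁ : ∀ n x g t → n + 4 * x + 24 * g + 4 * t ≡ n + 4 * x + (4 * t + 24 * g)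
    regroup₁ = solve-∀
    regroup₂ : ∀ n x → n + 4 * x + 3 * n ≡ 4 * (n + x)
    regroup₂ = solve-∀
    4y≥ : ∀ {y} → n + x ≤ y + t → n + 4 * x + 24 * g ≤ 4 * y
    4y≥ {y} n+x≤y+t = +-cancelʳ-≤ (4 * t) _ _ (begin
      n + 4 * x + 24 * g + 4 * t     ≡⟨ regroup₁ n x g t ⟩
      n + 4 * x + (4 * t + 24 * g)   ≤⟨ +-monoʳ-≤ (n + 4 * x) small ⟩
      n + 4 * x + 3 * n              ≡⟨ regroup₂ n x ⟩
      4 * (n + x)                    ≤⟨ *-monoʳ-≤ 4 n+x≤y+t ⟩
      4 * (y + t)                    ≡⟨ *-distribˡ-+ 4 y t ⟩
      4 * y + 4 * t                  ∎)

  -- Bounds independent of n, and the improvement step.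

  lineBad lineCost : (ℕ → ℕ) → ℕ → ℕ
  lineBad  B K = K + (B K + B K)
  lineCost G K = G K + suc K

  cellBad : (B G : ℕ → ℕ) → ℕ → ℕ
  cellBad B G K = lineBad B K + lineBad B (lineCost G K)

  cellCost : (G : ℕ → ℕ) → ℕ → ℕ
  cellCost G K = lineCost G (lineCost G K)

  -- The bounds of `freeIndex-expand` iterated over the stages. They depend on `Q`, the stage and
  -- `K` but not on n, so they can be fixed before n is chosen.
  indexBad indexCost : ℕ → ℕ → ℕ → ℕ
  indexBad Q zero    K = 0
  indexBad Q (suc i) K = indexBad Q i K + (Q * cellBad (indexBad Q i) (indexCost Q i) K + (K + K))
  indexCost Q zero    K = 0
  indexCost Q (suc i) K = indexCost Q i K + (2 + cellCost (indexCost Q i) K)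

  gridBad : ℕ → ℕ → ℕ
  gridBad Q i = cellBad (indexBad Q i) (indexCost Q i) 0

  module _ {n : ℕ} {L : Array n} (equi : IsEquiSquare L) {g Q : ℕ} .{{_ : NonZero g}} .{{_ : NonZero n}}
           (n≤Qg : n ≤ Q * g) (bad≤g : ∀ i → i ≤ Q → gridBad Q i ≤ g) where

    -- Without an enlargement every stage gains `g` indices, so stage `suc Q` would hold at least
    -- `suc Q * g > n` of them, although there are only `t ≤ n`.
    improve : ∀ {t} → Transversal L t → 4 * t + 24 * g ≤ 3 * n → Transversal L (suc t)
    improve {t} T₀ small = [ (λ T → T) , (λ big → contradiction big too-big) ]′ (grow (suc Q) ≤-refl)
      where
      open Switching T₀

      t≤n : t ≤ n
      t≤n = *-cancelˡ-≤ 4 (≤-trans (m≤m+n (4 * t) (24 * g)) (≤-trans small (*-monoˡ-≤ n (n≤1+n 3))))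

      stage : ℕ → List (Fin t)
      stage zero    = []
      stage (suc i) = expand g (stage i)

      freeIndex : ∀ i → IndexFreeing (stage i) (indexBad Q i) (indexCost Q i)
      freeIndex zero    K S _ = [] , z≤n , λ _ ()
      freeIndex (suc i) = freeIndex-expand {Q = Q} n≤Qg (freeIndex i) (freeCell (freeLine (freeIndex i)))

      grow : ∀ i → i ≤ suc Q → Transversal L (suc t) ⊎ i * g ≤ size (stage i)
      grow zero    _         = inj₂ z≤n
      grow (suc i) (s≤s i≤Q) with grow i (m≤n⇒m≤1+n i≤Q)
                                 | grid-bound equi g (freeCell (freeLine (freeIndex i)))
      ... | inj₁ T  | _          = inj₁ T
      ... | inj₂ _  | inj₁ T     = inj₁ T
      ... | inj₂ ih | inj₂ bound = inj₂ (≤-trans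
        (≤-trans (+-monoʳ-≤ g ih) (≤-reflexive (+-comm g _)))
        (growth small t≤n (bad≤g i i≤Q) (reachable-size true (stage i)) (reachable-size false (stage i)) bound))

      too-big : ¬ suc Q * g ≤ size (stage (suc Q))
      too-big big = <⇒≱ (≤-<-trans n≤Qg (m<n+m (Q * g) (>-nonZero⁻¹ g)))
        (≤-trans big (≤-trans (size≤t (stage (suc Q))) t≤n))

    large : ∃ λ t → Transversal L t × 3 * n ≤ 4 * t + 24 * g
    large = search (3 * n) empty (m≤m+n (3 * n) _)
      where
      empty : Transversal L 0
      empty = record { cell = λ () ; coord-inj = λ { _ {()} } ; symbol-inj = λ { {()} } }

      -- `m` is fuel: an improvement raises `4 * t` by 4, which outweighs the unit taken from `m`.
      -- With no fuel left the invariant is the conclusion itself.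
      search : ∀ m {t} → Transversal L t → 3 * n ≤ m + (4 * t + 24 * g) →
               ∃ λ t → Transversal L t × 3 * n ≤ 4 * t + 24 * g
      search zero    T bound = _ , T , bound
      search (suc m) {t} T bound with ≤-total (3 * n) (4 * t + 24 * g)
      ... | inj₁ done = t , T , done
      ... | inj₂ small = search m (improve T small) (≤-trans bound (begin
        suc m + (4 * t + 24 * g)         ≡⟨ +-suc m _ ⟨
        m + (1 + (4 * t + 24 * g))       ≤⟨ +-monoʳ-≤ m (+-monoˡ-≤ (4 * t + 24 * g) (s≤s (z≤n {3}))) ⟩
        m + (4 + (4 * t + 24 * g))       ≡⟨ regroup m t g ⟩
        m + (4 * suc t + 24 * g)         ∎))
        where
        open ≤-Reasoning
        regroup : ∀ m t g → m + (4 + (4 * t + 24 * g)) ≡ m + (4 * suc t + 24 * g)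
        regroup = solve-∀

  -- From indexed families to lists, and the choice of parameters.

  Transversal⇒IsTransversal : ∀ {n t} {L : Array n} → Transversal L t →
    Σ (List (Cell n)) λ T → IsTransversal L T × length T ≡ t
  Transversal⇒IsTransversal {n} {t} {L} T = map cell (allFin t) , record
    { rowsDistinct    = unique proj₁ (coord-inj true)
    ; colsDistinct    = unique proj₂ (coord-inj false)
    ; symbolsDistinct = unique (symbol L) symbol-inj
    } , trans (length-map cell (allFin t)) (length-allFin t)
    where
    open Transversal T
    unique : (f : Cell n → Fin n) → (∀ {j k} → f (cell j) ≡ f (cell k) → j ≡ k) →
             Unique (map f (map cell (allFin t)))
    unique f inj = subst Unique (map-∘ (allFin t)) (Unique.map⁺ inj (Unique.allFin⁺ t))

  -- The sum serves as a common upper bound for `gridBad Q i` over all i ≤ Q.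
  threshold : ℕ → ℕ
  threshold Q = ∑ (upTo (suc Q)) (gridBad Q)

  -- The step is g = `n / D`. The lower bound on n puts g above every relevant `gridBad` and makes
  -- it positive; the remainder is then at most `D ≤ g * D`, so `n ≤ 2 * D * g`, which is why Q =
  -- `2 * D`.
  large-transversal : ∀ D .{{_ : NonZero D}} n → suc (threshold (2 * D)) * D ≤ n →
    (L : Array n) → IsEquiSquare L → ∃ λ t → Transversal L t × 3 * n ≤ 4 * t + 24 * (n / D)
  large-transversal D n n≥ L equi =
    large {L = L} equi {n / D} {2 * D} {{>-nonZero (≤-trans (s≤s z≤n) threshold<g)}} {{n≢0 D n≥}} n≤Qg bad≤g
    where
    open ≤-Reasoning

    n≢0 : ∀ D .{{_ : NonZero D}} → suc (threshold (2 * D)) * D ≤ n → NonZero n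
    n≢0 (suc _) n≥ = >-nonZero (≤-trans (s≤s z≤n) n≥)

    threshold<g : suc (threshold (2 * D)) ≤ n / D
    threshold<g = begin
      suc (threshold (2 * D))              ≡⟨ m*n/n≡m (suc (threshold (2 * D))) D ⟨
      suc (threshold (2 * D)) * D / D      ≤⟨ /-monoˡ-≤ D n≥ ⟩
      n / D                                ∎

    n≤Qg : n ≤ 2 * D * (n / D)
    n≤Qg = begin
      n                            ≡⟨ m≡m%n+[m/n]*n n D ⟩
      n % D + n / D * D            ≤⟨ +-monoˡ-≤ (n / D * D) (m%n≤n n D) ⟩
      D + n / D * D
        ≤⟨ +-monoˡ-≤ (n / D * D) (m≤n*m D (n / D) {{>-nonZero (≤-trans (s≤s z≤n) threshold<g)}}) ⟩
      n / D * D + n / D * D        ≡⟨ double (n / D) D ⟩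
      2 * D * (n / D)              ∎
      where
      double : ∀ g D → g * D + g * D ≡ 2 * D * g
      double = solve-∀

    bad≤g : ∀ i → i ≤ 2 * D → gridBad (2 * D) i ≤ n / D
    bad≤g i i≤Q = begin
      gridBad (2 * D) i        ≤⟨ term≤∑ (gridBad (2 * D)) (∈-upTo⁺ (s≤s i≤Q)) ⟩
      threshold (2 * D)        ≤⟨ n≤1+n _ ⟩
      suc (threshold (2 * D))  ≤⟨ threshold<g ⟩
      n / D                    ∎

-- Rational ε and the conclusion.

open EquiSquare using (Transversal; threshold; large-transversal; Transversal⇒IsTransversal)
open import Data.Integer using (+_; -[1+_])
import Data.Integer as ℤ
import Data.Integer.Properties as ℤ
import Data.Integer.Tactic.RingSolver as ℤ-Ring
open import Data.Rational using (ℚ; mkℚ; *<*; toℚᵘ; _<_; _≤_; _-_; _*_; 0ℚ; _/_)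
import Data.Rational as ℚ
import Data.Rational.Properties as ℚ
open import Data.Rational.Unnormalised using (mkℚᵘ; *≤*; _≃_)
import Data.Rational.Unnormalised as ℚᵘ
import Data.Rational.Unnormalised.Properties as ℚᵘ

toℚᵘ-/1 : ∀ m → toℚᵘ (+ m / 1) ≃ mkℚᵘ (+ m) 0
toℚᵘ-/1 m = ℚ.toℚᵘ-fromℚᵘ (mkℚᵘ (+ m) 0)

-- Here ε = (a+1)/(d+1) ≥ 1/(d+1), and `gap` gives 24g ≤ 4n/(d+1) ≤ 4εn, so 3n ≤ 4t + 4εn.
-- `rearranged` is this inequality with denominators cleared.
[3/4-ε]n≤t : ∀ a d .(cop : Coprime (suc a) (suc d)) {n t g} →
  3 ℕ.* n ℕ.≤ 4 ℕ.* t ℕ.+ 24 ℕ.* g → g ℕ.* (6 ℕ.* suc d) ℕ.≤ n →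
  (+ 3 / 4 - mkℚ (+ suc a) d cop) * (+ n / 1) ≤ + t / 1
[3/4-ε]n≤t a d cop {n} {t} {g} 3n≤ gap = ℚ.toℚᵘ-cancel-≤
  (ℚᵘ.≤-respˡ-≃ (ℚᵘ.≃-sym left) (ℚᵘ.≤-respʳ-≃ (ℚᵘ.≃-sym (toℚᵘ-/1 t)) (*≤* cross)))
  where
  ε = mkℚ (+ suc a) d cop
  q = suc d

  left : toℚᵘ ((+ 3 / 4 - ε) * (+ n / 1)) ≃
         (mkℚᵘ (+ 3) 3 ℚᵘ.+ mkℚᵘ (ℤ.- (+ suc a)) d) ℚᵘ.* mkℚᵘ (+ n) 0
  left = ℚᵘ.≃-trans (ℚ.toℚᵘ-homo-* (+ 3 / 4 - ε) (+ n / 1))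
    (ℚᵘ.*-cong (ℚ.toℚᵘ-homo-+ (+ 3 / 4) (ℚ.- ε)) (toℚᵘ-/1 n))

  rearranged : 3 ℕ.* q ℕ.* n ℕ.≤ 4 ℕ.* q ℕ.* t ℕ.+ 4 ℕ.* suc a ℕ.* n
  rearranged = begin
    3 ℕ.* q ℕ.* n                           ≡⟨ swap q n ⟩
    q ℕ.* (3 ℕ.* n)                         ≤⟨ ℕ.*-monoʳ-≤ q 3n≤ ⟩
    q ℕ.* (4 ℕ.* t ℕ.+ 24 ℕ.* g)            ≡⟨ regroup q t g ⟩
    4 ℕ.* q ℕ.* t ℕ.+ 4 ℕ.* (g ℕ.* (6 ℕ.* q))
      ≤⟨ ℕ.+-monoʳ-≤ (4 ℕ.* q ℕ.* t) (ℕ.*-monoʳ-≤ 4 gap) ⟩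
    4 ℕ.* q ℕ.* t ℕ.+ 4 ℕ.* n
      ≤⟨ ℕ.+-monoʳ-≤ (4 ℕ.* q ℕ.* t) (ℕ.*-monoˡ-≤ n (ℕ.m≤m*n 4 (suc a))) ⟩
    4 ℕ.* q ℕ.* t ℕ.+ 4 ℕ.* suc a ℕ.* n     ∎
    where
    open ℕ.≤-Reasoning
    swap : ∀ q n → 3 ℕ.* q ℕ.* n ≡ q ℕ.* (3 ℕ.* n)
    swap = ℕ-Ring.solve-∀
    regroup : ∀ q t g → q ℕ.* (4 ℕ.* t ℕ.+ 24 ℕ.* g) ≡ 4 ℕ.* q ℕ.* t ℕ.+ 4 ℕ.* (g ℕ.* (6 ℕ.* q))
    regroup = ℕ-Ring.solve-∀

  cast : ∀ x y z → + (x ℕ.* y ℕ.* z) ≡ + x ℤ.* + y ℤ.* + z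
  cast x y z = trans (ℤ.pos-* (x ℕ.* y) z) (cong (ℤ._* + z) (ℤ.pos-* x y))

  cross : (+ 3 ℤ.* + q ℤ.+ ℤ.- (+ suc a) ℤ.* + 4) ℤ.* + n ℤ.* + 1 ℤ.≤ + t ℤ.* + (4 ℕ.* q ℕ.* 1)
  cross = begin
    (+ 3 ℤ.* + q ℤ.+ ℤ.- (+ suc a) ℤ.* + 4) ℤ.* + n ℤ.* + 1
      ≡⟨ lhs (+ q) (+ suc a) (+ n) ⟩
    + 3 ℤ.* + q ℤ.* + n ℤ.- + 4 ℤ.* + suc a ℤ.* + n
      ≡⟨ cong₂ ℤ._-_ (cast 3 q n) (cast 4 (suc a) n) ⟨
    + (3 ℕ.* q ℕ.* n) ℤ.- + (4 ℕ.* suc a ℕ.* n)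
      ≤⟨ ℤ.+-monoˡ-≤ (ℤ.- + (4 ℕ.* suc a ℕ.* n)) (ℤ.+≤+ rearranged) ⟩
    + (4 ℕ.* q ℕ.* t) ℤ.+ + (4 ℕ.* suc a ℕ.* n) ℤ.- + (4 ℕ.* suc a ℕ.* n)
      ≡⟨ cancel (+ (4 ℕ.* q ℕ.* t)) (+ (4 ℕ.* suc a ℕ.* n)) ⟩
    + (4 ℕ.* q ℕ.* t)
      ≡⟨ cong +_ (rhs q t) ⟩
    + (t ℕ.* (4 ℕ.* q ℕ.* 1))
      ≡⟨ ℤ.pos-* t (4 ℕ.* q ℕ.* 1) ⟩
    + t ℤ.* + (4 ℕ.* q ℕ.* 1) ∎
    where
    open ℤ.≤-Reasoning
    lhs : ∀ q a n → (+ 3 ℤ.* q ℤ.+ ℤ.- a ℤ.* + 4) ℤ.* n ℤ.* + 1 ≡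
                    + 3 ℤ.* q ℤ.* n ℤ.- + 4 ℤ.* a ℤ.* n
    lhs = ℤ-Ring.solve-∀
    cancel : ∀ i j → i ℤ.+ j ℤ.- j ≡ i
    cancel = ℤ-Ring.solve-∀
    rhs : ∀ q t → 4 ℕ.* q ℕ.* t ≡ t ℕ.* (4 ℕ.* q ℕ.* 1)
    rhs = ℕ-Ring.solve-∀

theorem1p3 : (ε : ℚ) → 0ℚ < ε →
    Σ ℕ (λ n₀ → (n : ℕ) → n ≥ n₀ → (L : Array n) → IsEquiSquare L →
    Σ (List (Fin n × Fin n)) (λ T → IsTransversal L T ×
    ((+ 3 / 4 - ε) * (+ n / 1) ≤ (+ length T / 1))))
theorem1p3 (mkℚ (+ 0) d cop) (*<* (ℤ.+<+ ()))
theorem1p3 (mkℚ -[1+ _ ] d cop) (*<* ())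
theorem1p3 ε@(mkℚ (+ suc a) d cop) _ = suc (threshold (2 ℕ.* D)) ℕ.* D , λ n n≥ L equi →
  conclude (large-transversal D n n≥ L equi)
  where
  -- The factor 6 makes the loss 24⌊n/D⌋ at most 4n/(d+1), hence at most 4εn.
  D = 6 ℕ.* suc d

  conclude : ∀ {n} {L : Array n} →
    Σ ℕ (λ t → Transversal L t × 3 ℕ.* n ℕ.≤ 4 ℕ.* t ℕ.+ 24 ℕ.* (n ℕ./ D)) →
    Σ (List (Fin n × Fin n)) λ T → IsTransversal L T × (+ 3 / 4 - ε) * (+ n / 1) ≤ + length T / 1
  conclude {n} (t , T , 3n≤) =
    let cs , isT , |cs|≡t = Transversal⇒IsTransversal T
    in cs , isT , subst (λ m → (+ 3 / 4 - ε) * (+ n / 1) ≤ + m / 1) (sym |cs|≡t)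
                        ([3/4-ε]n≤t a d cop {t = t} {g = n ℕ./ D} 3n≤ (ℕ.m/n*n≤m n D))
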